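{- For $n\in\mathbb{N}^+$, let $\mathrm{PHP}_n$ denote the pigeonhole principle formula $$\mathrm{PHP}_n=\bigcup_{i\in[n+1]}\{p_{i,1}\lor\dots\lor p_{i,n}\}\ \cup\bigcup_{\substack{i,j\in[n+1],\ i\neq j\\ k\in[n]}}\{\overline{p_{i,k}}\lor\overline{p_{j,k}}\}$$ over distinct propositional variables $p_{i,k}$ ($i\in[n+1]$, $k\in[n]$). Then $\mathrm{size}_{\mathsf{SBC}^- }(\mathrm{PHP}_n)=n^{O(1)}$.
   Context: $[n]=\{1,\dots,n\}$. A literal is a propositional variable or its negation; $\overline{p}$ is the complement of $p$, and $\overline{L}=\{\overline{p} : p\in L\}$ for a set $L$ of literals. A set of literals is tautological if it contains some $x$ and $\overline{x}$. A clause is a finite nontautological set of literals (read as a disjunction); $\bot$ is the empty clause. A CNF is a finite set of clauses; $\mathrm{var}(\Gamma)$ is the set of variables occurring in $\Gamma$. If $A\cup\{x\}$ and $B\cup\{\overline{x}\}$ are clauses with $x$ a variable not occurring in $A$ or $B$, and $A\cup B$ is a clause, then $A\cup B$ is their resolvent on $x$. A weakening of a clause $A$ is any clause $A\cup B$. A clause $C$ is a set-blocked clause (SBC) for a nonempty $L\subseteq C$ with respect to $\Gamma$ if for every $D\in\Gamma$ with $D\cap\overline{L}\neq\varnothing$ and $D\cap L=\varnothing$ the set $(C\setminus L)\cup(D\setminus\overline{L})$ is tautological. $C$ is an SBC with respect to $\Gamma$ if it is one for some nonempty $L\subseteq C$. An $\mathsf{SBC}^-$ proof (refutation) of $\Gamma$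 is a sequence $(\Gamma_1,\dots,\Gamma_N)$ of CNFs with $\Gamma_1=\Gamma$, $\bot\in\Gamma_N$, in which only variables of $\mathrm{var}(\Gamma)$ occur, and each $\Gamma_{i+1}=\Gamma_i\cup\{C\}$, where $C$ is a resolvent of two clauses of $\Gamma_i$, a weakening of a clause of $\Gamma_i$, or an SBC with respect to $\Gamma_i$. Its size is $N$; $\mathrm{size}_{\mathsf{SBC}^- }(\Gamma)$ is the minimum size of an $\mathsf{SBC}^-$ proof of $\Gamma$. -}

module Defs where

open import Data.Fin using (Fin)
open import Data.Fin.Properties using (_≟_)
open import Data.List using (List; []; _∷_; _++_; map; concatMap; filter; allFin; cartesianProduct)
open import Data.List.Membership.Propositional using (_∈_; _∉_)
open import Data.List.Membership.Propositional.Properties using (∈-map⁻)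
open import Data.List.Relation.Binary.BagAndSetEquality using (_∼[_]_; set)
open import Data.List.Relation.Binary.Subset.Propositional using (_⊆_)
open import Data.List.Relation.Unary.Any using (here; there)
open import Data.Nat using (ℕ; suc; _≤_; _^_)
open import Data.Product using (_×_; _,_; ∃; ∃-syntax)
open import Function using (_∘_)
open import Level using (0ℓ)
open import Relation.Binary.PropositionalEquality using (_≡_; _≢_)
open import Relation.Nullary using (¬_)
open import Relation.Nullary.Decidable using (¬?)
open import Relation.Unary using (Pred; _∪_; _∖_; _≬_; _⊥_)

-- Finite sets (of literals, of clauses) are lists in which order and repetition
-- carry no meaning; equality of finite sets of literals is _∼[ set ]_.

data Literal (V : Set) : Set where
  pos neg : V → Literal V

complement : ∀ {V} → Literal V → Literal V
complement (pos x) = neg x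
complement (neg x) = pos x

variableOf : ∀ {V} → Literal V → V
variableOf (pos x) = x
variableOf (neg x) = x

⟦_⟧ : ∀ {V} → List (Literal V) → Pred (Literal V) 0ℓ
⟦ L ⟧ = _∈ L

Tautological : ∀ {V} → Pred (Literal V) 0ℓ → Set
Tautological P = ∃[ x ] P (pos x) × P (neg x)

-- The proof field is irrelevant, so a clause is determined by its list of literals.
record Clause (V : Set) : Set where
  constructor clause
  field
    literals           : List (Literal V)
    .nontautological   : ¬ Tautological ⟦ literals ⟧

open Clause public

CNF : Set → Set
CNF V = List (Clause V)

⊥ᶜ : ∀ {V} → Clause V
⊥ᶜ = clause [] λ { (_ , () , _) }

varsL : ∀ {V} → List (Literal V) → List V
varsL = map variableOf

var : ∀ {V} → CNF V → List V
var = concatMap (varsL ∘ literals)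

record IsResolvent {V} (E F C : Clause V) : Set where
  field
    x     : V
    A B   : List (Literal V)
    left  : literals E ∼[ set ] pos x ∷ A
    right : literals F ∼[ set ] neg x ∷ B
    x∉A   : x ∉ varsL A
    x∉B   : x ∉ varsL B
    union : literals C ∼[ set ] A ++ B

IsWeakening : ∀ {V} → Clause V → Clause V → Set
IsWeakening A C = ∃[ B ] literals C ∼[ set ] literals A ++ B

record SetBlockedFor {V} (L : List (Literal V)) (Γ : CNF V) (C : Clause V) : Set where
  L̄ : List (Literal V)
  L̄ = map complement L
  field
    nonempty : L ≢ []
    subset   : L ⊆ literals C
    blocked  : ∀ D → D ∈ Γ → ⟦ literals D ⟧ ≬ ⟦ L̄ ⟧ → ⟦ literals D ⟧ ⊥ ⟦ L ⟧ →
               Tautological ((⟦ literals C ⟧ ∖ ⟦ L ⟧) ∪ (⟦ literals D ⟧ ∖ ⟦ L̄ ⟧))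

SetBlocked : ∀ {V} → CNF V → Clause V → Set
SetBlocked Γ C = ∃[ L ] SetBlockedFor L Γ C

data Inference {V} (Γ : CNF V) (C : Clause V) : Set where
  resolution : ∀ {E F} → E ∈ Γ → F ∈ Γ → IsResolvent E F C → Inference Γ C
  weakening  : ∀ {A} → A ∈ Γ → IsWeakening A C → Inference Γ C
  setBlocked : SetBlocked Γ C → Inference Γ C

-- Derivation Γ Δ N: the sequences (Γ₁, …, Γ_N) with Γ₁ = Γ and Γ_N = Δ.
data Derivation {V} (Γ : CNF V) : CNF V → ℕ → Set where
  start : Derivation Γ Γ 1
  _▸_   : ∀ {Δ N C} → Derivation Γ Δ N →
          varsL (literals C) ⊆ var Γ × Inference Δ C →
          Derivation Γ (C ∷ Δ) (suc N)

Refutation : ∀ {V} → CNF V → ℕ → Set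
Refutation Γ N = ∃[ Δ ] Derivation Γ Δ N × ⊥ᶜ ∈ Δ

-- IsSize Γ s: the minimum size of a refutation of Γ exists and equals s.
IsSize : ∀ {V} → CNF V → ℕ → Set
IsSize Γ s = Refutation Γ s × (∀ N → Refutation Γ N → s ≤ N)

-- (i , k) is the variable p_{i+1,k+1}.
PVar : ℕ → Set
PVar n = Fin (suc n) × Fin n

pigeonClause : ∀ n → Fin (suc n) → Clause (PVar n)
pigeonClause n i = clause (map (λ k → pos (i , k)) (allFin n)) nontaut
  where
  nontaut : ¬ Tautological ⟦ map (λ k → pos (i , k)) (allFin n) ⟧
  nontaut (_ , _ , q) with ∈-map⁻ (λ k → pos (i , k)) q
  ... | _ , _ , ()

holeClause : ∀ n → Fin (suc n) × Fin (suc n) × Fin n → Clause (PVar n)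
holeClause n (i , j , k) = clause (neg (i , k) ∷ neg (j , k) ∷ []) nontaut
  where
  nontaut : ¬ Tautological ⟦ neg (i , k) ∷ neg (j , k) ∷ [] ⟧
  nontaut (_ , here () , _)
  nontaut (_ , there (here ()) , _)
  nontaut (_ , there (there ()) , _)

PHP : ∀ n → CNF (PVar n)
PHP n = map (pigeonClause n) (allFin (suc n))
     ++ map (holeClause n)
          (filter (λ (i , j , _) → ¬? (i ≟ j))
            (cartesianProduct (allFin (suc n))
              (cartesianProduct (allFin (suc n)) (allFin n))))

-- f(n) = n^{O(1)} as n → ∞: the exponent is bounded for all large n.
-- (A bound n^c cannot be asked at n = 1, where it would say f(1) ≤ 1.)
PolynomiallyBounded : (ℕ → ℕ) → Set
PolynomiallyBounded f = ∃[ c ] ∃[ n₀ ] ∀ n → n₀ ≤ n → f n ≤ n ^ c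

{-# OPTIONS --safe #-}
module Submission where

-- For h = n - 1, ..., 0, pigeon h + 1 is removed together with hole h. For i ≤ h and k < h,
-- the clause ¬p(i,h) ∨ ¬p(h+1,k) holds without loss of generality: otherwise let the two
-- pigeons exchange their holes. Set-blocked clauses express this exchange as the flip of
-- p(i,h), p(h+1,k), p(i,k), p(h+1,h), once the clause also contains p(j,h) and p(j,k) for
-- every third pigeon j; these literals are then resolved away with the hole clauses.
-- From ¬p(i,h) ∨ ¬p(h+1,k) for all k < h one gets ¬p(i,h), and the clause of pigeon i loses
-- hole h. Clauses are never deleted, so the inferred ones must not obstruct a later exchange;
-- this is the invariant Below.
--
-- A minimum size exists constructively because, up to set equality, only finitely many
-- clauses over var(Γ) exist, so that it is decidable whether a refutation of size N exists.

open import Defs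
open import Data.Empty using (⊥-elim; ⊥-elim-irr)
open import Data.Fin using (Fin; zero; suc; toℕ; fromℕ<)
open import Data.Fin.Properties using (_≟_; toℕ-injective; toℕ<n; toℕ-fromℕ<)
open import Data.List using (List; []; _∷_; _++_; map; concatMap; filter; length; allFin; cartesianProduct)
open import Data.List.Properties using (length-tabulate; length-map; length-++; length-filter; filter-all; map-∘)
open import Data.List.Membership.Propositional using (_∈_; _∉_; find; lose)
open import Data.List.Membership.Propositional.Properties
open import Data.List.Relation.Binary.BagAndSetEquality using (_∼[_]_; set)
open import Data.List.Relation.Binary.Subset.Propositional using (_⊆_)
open import Data.List.Relation.Unary.All as All using (all?)
open import Data.List.Relation.Unary.Any using (Any; any?; here; there)
open import Data.Nat using (ℕ; zero; suc; _+_; _*_; _^_; NonZero; _≤_; _<_; z≤n; s≤s)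
open import Data.Nat.Properties using
  ( ≤-refl ; ≤-trans ; ≤-reflexive ; _≤?_ ; _<?_ ; <-≤-trans ; <-trans ; <⇒≱ ; <⇒≤
  ; 1+n≰n ; n≮n ; n≤1+n ; m≤m+n ; m≤n+m ; m≤n⇒m<n∨m≡n ; m<1+n⇒m≤n ; +-comm ; +-suc
  ; +-mono-≤ ; +-monoʳ-≤ ; +-monoˡ-≤ ; *-identityʳ ; *-mono-≤ ; *-monoʳ-≤ ; m^n>0
  ; ^-distribˡ-+-* ; ^-monoʳ-≤ ; module ≤-Reasoning)
open import Data.Product using (_×_; _,_; ∃-syntax; proj₁; proj₂)
open import Data.Product.Properties using (≡-dec)
open import Data.Sum using (_⊎_; inj₁; inj₂; [_,_]′)
open import Data.Unit using (⊤)
open import Function using (_∘_; id; mk⇔; Equivalence)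
open import Level using (0ℓ)
open import Relation.Binary.Definitions using (DecidableEquality)
open import Relation.Binary.PropositionalEquality using (_≡_; _≢_; refl; sym; trans; cong; subst)
open import Relation.Nullary using (¬_; Dec; yes; no)
open import Relation.Nullary.Decidable using (map′; ¬?; _×-dec_; _⊎-dec_; _→-dec_)
open import Relation.Unary using (Pred; Decidable; _∪_; _∖_; _≬_; _⊥_)

-- Least witnesses, finite subsets, and lists as sets.

nonempty? : ∀ {A : Set} (xs : List A) → Dec (xs ≢ [])
nonempty? []      = no λ n → n refl
nonempty? (_ ∷ _) = yes λ ()

least : ∀ {P : ℕ → Set} → Decidable P → ∀ n → P n → ∃[ s ] P s × (∀ m → P m → s ≤ m)
least P? n p with P? 0
least P? n       p | yes p₀ = 0 , p₀ , λ _ _ → z≤n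
least P? zero    p | no ¬p₀ = ⊥-elim (¬p₀ p)
least P? (suc n) p | no ¬p₀ with least (P? ∘ suc) n p
... | s , ps , min = suc s , ps , λ { zero q → ⊥-elim (¬p₀ q) ; (suc m) q → s≤s (min m q) }

subsets : ∀ {A : Set} → List A → List (List A)
subsets []       = [] ∷ []
subsets (x ∷ xs) = subsets xs ++ map (x ∷_) (subsets xs)

-- A set `K` inside `xs` is represented by `filter (_∈? K) xs`, so `subsets xs` meets every subset
-- up to set equality.
filter∈subsets : ∀ {A : Set} {P : Pred A 0ℓ} (P? : Decidable P) xs → filter P? xs ∈ subsets xs
filter∈subsets P? []       = here refl
filter∈subsets P? (x ∷ xs) with P? x
... | yes _ = ∈-++⁺ʳ (subsets xs) (∈-map⁺ (x ∷_) (filter∈subsets P? xs))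
... | no  _ = ∈-++⁺ˡ (filter∈subsets P? xs)

module _ {A : Set} where

  set⁺ : {xs ys : List A} → xs ⊆ ys → ys ⊆ xs → xs ∼[ set ] ys
  set⁺ p q = mk⇔ p q

  set-⊆ : {xs ys : List A} → xs ∼[ set ] ys → xs ⊆ ys
  set-⊆ e = Equivalence.to e

  set-⊇ : {xs ys : List A} → xs ∼[ set ] ys → ys ⊆ xs
  set-⊇ e = Equivalence.from e

  set-sym : {xs ys : List A} → xs ∼[ set ] ys → ys ∼[ set ] xs
  set-sym e = set⁺ (set-⊇ e) (set-⊆ e)

  set-trans : {xs ys zs : List A} → xs ∼[ set ] ys → ys ∼[ set ] zs → xs ∼[ set ] zs
  set-trans e f = set⁺ (set-⊆ f ∘ set-⊆ e) (set-⊇ e ∘ set-⊇ f)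

  set-++ : {xs xs′ ys ys′ : List A} → xs ∼[ set ] xs′ → ys ∼[ set ] ys′ →
           xs ++ ys ∼[ set ] xs′ ++ ys′
  set-++ {xs} {xs′} e f =
    set⁺ ([ ∈-++⁺ˡ ∘ set-⊆ e , ∈-++⁺ʳ xs′ ∘ set-⊆ f ]′ ∘ ∈-++⁻ xs)
         ([ ∈-++⁺ˡ ∘ set-⊇ e , ∈-++⁺ʳ xs ∘ set-⊇ f ]′ ∘ ∈-++⁻ xs′)

-- Invariance of the inference rules under set equality.

module _ {V : Set} where

  Taut-map : (P Q : Pred (Literal V) 0ℓ) → (∀ {l} → P l → Q l) → Tautological P → Tautological Q
  Taut-map _ _ f (x , p , q) = x , f p , f q

  ∈-varsL⁻ : ∀ {x : V} K → x ∈ varsL K → pos x ∈ K ⊎ neg x ∈ K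
  ∈-varsL⁻ K p with ∈-map⁻ variableOf p
  ... | pos _ , q , refl = inj₁ q
  ... | neg _ , q , refl = inj₂ q

  varsL-mono : {K L : List (Literal V)} → K ⊆ L → varsL K ⊆ varsL L
  varsL-mono K⊆L p with ∈-map⁻ variableOf p
  ... | _ , q , refl = ∈-map⁺ variableOf (K⊆L q)

  weaken⁺ : {A C : Clause V} → literals A ⊆ literals C → IsWeakening A C
  weaken⁺ {A} {C} A⊆C =
    literals C , set⁺ (∈-++⁺ʳ (literals A)) ([ A⊆C , id ]′ ∘ ∈-++⁻ (literals A))

  infix 4 _≈_ _≼_

  _≈_ : Clause V → Clause V → Set
  E ≈ F = literals E ∼[ set ] literals F

  _≼_ : CNF V → CNF V → Set
  Γ ≼ Δ = ∀ {E} → E ∈ Γ → ∃[ F ] F ∈ Δ × E ≈ F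

  -- Only the empty list has no members, and the irrelevant proof field leaves a single clause on
  -- it.
  ⊥ᶜ-unique : ∀ {E} → ⊥ᶜ ≈ E → ⊥ᶜ ≡ E
  ⊥ᶜ-unique {clause []      _} e = refl
  ⊥ᶜ-unique {clause (_ ∷ _) _} e with set-⊇ e (here refl)
  ... | ()

  empty? : (E : Clause V) → Dec (⊥ᶜ ≡ E)
  empty? (clause []      _) = yes refl
  empty? (clause (_ ∷ _) _) = no λ ()

  ≼-∷ : ∀ {Γ Δ E F} → E ≈ F → Γ ≼ Δ → E ∷ Γ ≼ F ∷ Δ
  ≼-∷ {F = F} e s (here refl) = F , here refl , e
  ≼-∷ e s (there p) with s p
  ... | G , q , f = G , there q , f

  resolvent-resp : ∀ {E F C E′ F′ C′} → E ≈ E′ → F ≈ F′ → C ≈ C′ →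
                   IsResolvent E F C → IsResolvent E′ F′ C′
  resolvent-resp e f c r = record
    { x = x ; A = A ; B = B
    ; left = set-trans (set-sym e) left
    ; right = set-trans (set-sym f) right
    ; x∉A = x∉A ; x∉B = x∉B
    ; union = set-trans (set-sym c) union }
    where open IsResolvent r

  -- Blocking is a condition on every clause of the CNF, so it passes to a CNF with fewer clauses;
  -- hence the direction `Δ′ ≼ Δ`.
  setBlockedFor-resp : ∀ {Δ Δ′ C C′ L L′} → Δ′ ≼ Δ → C ≈ C′ → L ∼[ set ] L′ →
                       SetBlockedFor L Δ C → SetBlockedFor L′ Δ′ C′
  setBlockedFor-resp {Δ} {Δ′} {C} {C′} {L} {L′} s c ℓ b = record
    { nonempty = λ { refl → L≢[] nonempty (set-⊆ ℓ) }
    ; subset   = set-⊆ c ∘ subset ∘ set-⊇ ℓ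
    ; blocked  = blocked′ }
    where
    open SetBlockedFor b
    L≢[] : ∀ {K : List (Literal V)} → K ≢ [] → ¬ (K ⊆ [])
    L≢[] {[]}    n _ = n refl
    L≢[] {_ ∷ _} _ p with p (here refl)
    ... | ()
    L̄-mono : {K K′ : List (Literal V)} → K ⊆ K′ → map complement K ⊆ map complement K′
    L̄-mono p q with ∈-map⁻ complement q
    ... | _ , r , refl = ∈-map⁺ complement (p r)
    blocked′ : ∀ D → D ∈ Δ′ → ⟦ literals D ⟧ ≬ ⟦ map complement L′ ⟧ → ⟦ literals D ⟧ ⊥ ⟦ L′ ⟧ →
               Tautological ((⟦ literals C′ ⟧ ∖ ⟦ L′ ⟧) ∪ (⟦ literals D ⟧ ∖ ⟦ map complement L′ ⟧))
    blocked′ D D∈ (l , l∈D , l∈L̄) D⊥L with s D∈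
    ... | F , F∈ , d = Taut-map
      ((⟦ literals C ⟧ ∖ ⟦ L ⟧) ∪ (⟦ literals F ⟧ ∖ ⟦ map complement L ⟧))
      ((⟦ literals C′ ⟧ ∖ ⟦ L′ ⟧) ∪ (⟦ literals D ⟧ ∖ ⟦ map complement L′ ⟧))
      (λ { (inj₁ (p , q)) → inj₁ (set-⊆ c p , q ∘ set-⊇ ℓ)
         ; (inj₂ (p , q)) → inj₂ (set-⊇ d p , q ∘ L̄-mono (set-⊇ ℓ)) })
      (blocked F F∈ (l , set-⊆ d l∈D , L̄-mono (set-⊇ ℓ) l∈L̄)
        (λ { (p , q) → D⊥L (set-⊇ d p , set-⊆ ℓ q) }))

  -- Resolution and weakening carry their premises from `Δ` to `Δ′`, while blocking traces the
  -- clauses of `Δ′` back to `Δ`; hence both directions.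
  inference-resp : ∀ {Δ Δ′ C C′} → Δ ≼ Δ′ → Δ′ ≼ Δ → C ≈ C′ → Inference Δ C → Inference Δ′ C′
  inference-resp s t c (resolution E∈ F∈ r) with s E∈ | s F∈
  ... | _ , E′∈ , e | _ , F′∈ , f = resolution E′∈ F′∈ (resolvent-resp e f c r)
  inference-resp {C′ = C′} s t c (weakening A∈ (_ , w)) with s A∈
  ... | A′ , A′∈ , a = weakening A′∈ (weaken⁺ {A′} {C′} (set-⊆ c ∘ set-⊇ w ∘ ∈-++⁺ˡ ∘ set-⊇ a))
  inference-resp s t c (setBlocked (L , b)) =
    setBlocked (L , setBlockedFor-resp t c (set⁺ id id) b)

-- Decidability of the inference rules.

module _ {V : Set} (_≟_ : DecidableEquality V) where

  ≟-Literal : DecidableEquality (Literal V)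
  ≟-Literal (pos x) (pos y) = map′ (cong pos) (cong variableOf) (x ≟ y)
  ≟-Literal (pos x) (neg y) = no λ ()
  ≟-Literal (neg x) (pos y) = no λ ()
  ≟-Literal (neg x) (neg y) = map′ (cong neg) (cong variableOf) (x ≟ y)

  open import Data.List.Membership.DecPropositional ≟-Literal using (_∈?_)
  open import Data.List.Membership.DecPropositional _≟_ using () renaming (_∈?_ to _∈ᵛ?_)

  _⊆?_ : (K L : List (Literal V)) → Dec (K ⊆ L)
  K ⊆? L = map′ (λ a → All.lookup a) (λ f → All.tabulate f) (all? (_∈? L) K)

  _⊆ᵛ?_ : (xs ys : List V) → Dec (xs ⊆ ys)
  xs ⊆ᵛ? ys = map′ (λ a → All.lookup a) (λ f → All.tabulate f) (all? (_∈ᵛ? ys) xs)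

  _∼?_ : (K L : List (Literal V)) → Dec (K ∼[ set ] L)
  K ∼? L with K ⊆? L | L ⊆? K
  ... | yes p | yes q = yes (set⁺ p q)
  ... | no ¬p | _     = no λ e → ¬p (set-⊆ e)
  ... | yes _ | no ¬q = no λ e → ¬q (set-⊇ e)

  _≬?_ : (K L : List (Literal V)) → Dec (⟦ K ⟧ ≬ ⟦ L ⟧)
  K ≬? L = map′ find (λ { (_ , p , q) → lose p q }) (any? (_∈? L) K)

  _⊥?_ : (K L : List (Literal V)) → Dec (⟦ K ⟧ ⊥ ⟦ L ⟧)
  K ⊥? L with K ≬? L
  ... | yes (_ , p , q) = no λ d → d (p , q)
  ... | no  n           = yes λ { (p , q) → n (_ , p , q) }

  tautological? : ∀ {P : Pred (Literal V) 0ℓ} → Decidable P → ∀ K → (∀ {l} → P l → l ∈ K) →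
                  Dec (Tautological P)
  tautological? P? K P⊆K =
    map′ (λ a → let x , _ , p = find a in x , p)
         (λ { (x , p , q) → lose (∈-map⁺ variableOf (P⊆K p)) (p , q) })
         (any? (λ x → P? (pos x) ×-dec P? (neg x)) (varsL K))

  remove : Literal V → List (Literal V) → List (Literal V)
  remove l = filter (λ m → ¬? (≟-Literal m l))

  -- Premise and pivot determine the rest of the premise, so deciding resolution is a search for the
  -- pivot alone.
  remove-∼ : ∀ {l A E} → l ∉ A → E ∼[ set ] l ∷ A → A ∼[ set ] remove l E
  remove-∼ {l} {A} {E} l∉A e = set⁺
    (λ p → ∈-filter⁺ _ (set-⊇ e (there p)) (λ { refl → l∉A p }))
    (λ p → let q , m≢l = ∈-filter⁻ _ p in strip m≢l (set-⊆ e q))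
    where
    strip : ∀ {m} → m ≢ l → m ∈ l ∷ A → m ∈ A
    strip n (here m≡l) = ⊥-elim (n m≡l)
    strip n (there p)  = p

  ∷-remove-∼ : ∀ {l E} → l ∈ E → E ∼[ set ] l ∷ remove l E
  ∷-remove-∼ {l} {E} l∈E = set⁺ f λ { (here refl) → l∈E ; (there p) → proj₁ (∈-filter⁻ _ p) }
    where
    f : E ⊆ l ∷ remove l E
    f {m} m∈E with ≟-Literal m l
    ... | yes m≡l = here m≡l
    ... | no  m≢l = there (∈-filter⁺ _ m∈E m≢l)

  variable∉remove : ∀ {l K} → complement l ∉ K → variableOf l ∉ varsL (remove l K)
  variable∉remove {l} {K} n p with l | ∈-varsL⁻ (remove l K) p
  ... | pos x | inj₁ q = proj₂ (∈-filter⁻ _ {xs = K} q) refl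
  ... | pos x | inj₂ q = n (proj₁ (∈-filter⁻ _ q))
  ... | neg x | inj₁ q = n (proj₁ (∈-filter⁻ _ q))
  ... | neg x | inj₂ q = proj₂ (∈-filter⁻ _ {xs = K} q) refl

  isResolvent? : ∀ E F C → Dec (IsResolvent E F C)
  isResolvent? E F C = map′ sound complete (any? on? (varsL (literals E)))
    where
    On : V → Set
    -- `remove` deletes one sign of `x`; the absence of the other sign yields `x∉A` and `x∉B`.
    On x = (pos x ∈ literals E × neg x ∉ literals E) ×
           (neg x ∈ literals F × pos x ∉ literals F) ×
           literals C ∼[ set ] remove (pos x) (literals E) ++ remove (neg x) (literals F)
    on? : Decidable On
    on? x = (pos x ∈? literals E ×-dec ¬? (neg x ∈? literals E)) ×-dec
            (neg x ∈? literals F ×-dec ¬? (pos x ∈? literals F)) ×-dec (_ ∼? _)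
    sound : Any On (varsL (literals E)) → IsResolvent E F C
    sound a with find a
    ... | x , _ , (p , p′) , (q , q′) , u = record
      { x = x ; left = ∷-remove-∼ p ; right = ∷-remove-∼ q
      ; x∉A = variable∉remove p′ ; x∉B = variable∉remove q′ ; union = u }
    complete : IsResolvent E F C → Any On (varsL (literals E))
    complete r = lose (∈-map⁺ variableOf (set-⊇ left (here refl)))
      ( (set-⊇ left (here refl) , λ p → absent (set-⊆ left p))
      , (set-⊇ right (here refl) , λ p → absent′ (set-⊆ right p))
      , set-trans union (set-++ (remove-∼ (x∉A ∘ ∈-map⁺ variableOf) left)
                                (remove-∼ (x∉B ∘ ∈-map⁺ variableOf) right)))
      where
      open IsResolvent r
      absent : neg x ∉ pos x ∷ A
      absent (there p) = x∉A (∈-map⁺ variableOf p)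
      absent′ : pos x ∉ neg x ∷ B
      absent′ (there p) = x∉B (∈-map⁺ variableOf p)

  isWeakening? : ∀ A C → Dec (IsWeakening A C)
  isWeakening? A C with literals A ⊆? literals C
  ... | yes A⊆C = yes (weaken⁺ {A = A} {C} A⊆C)
  ... | no  n   = no λ { (_ , w) → n (set-⊇ w ∘ ∈-++⁺ˡ) }

  module _ (L : List (Literal V)) (Γ : CNF V) (C : Clause V) where

    Blocked : Clause V → Set
    Blocked D = ⟦ literals D ⟧ ≬ ⟦ map complement L ⟧ → ⟦ literals D ⟧ ⊥ ⟦ L ⟧ →
                Tautological ((⟦ literals C ⟧ ∖ ⟦ L ⟧) ∪ (⟦ literals D ⟧ ∖ ⟦ map complement L ⟧))

    blocked? : Decidable Blocked
    blocked? D with literals D ⊥? L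
    ... | no  n = yes λ _ d → ⊥-elim (n d)
    ... | yes d = map′ (λ f t _ → f t) (λ f t → f t d)
      ((literals D ≬? map complement L) →-dec
       tautological? (λ l → (l ∈? literals C ×-dec ¬? (l ∈? L)) ⊎-dec
                            (l ∈? literals D ×-dec ¬? (l ∈? map complement L)))
         (literals C ++ literals D) [ ∈-++⁺ˡ ∘ proj₁ , ∈-++⁺ʳ (literals C) ∘ proj₁ ]′)

    setBlockedFor? : Dec (SetBlockedFor L Γ C)
    setBlockedFor? with nonempty? L | L ⊆? literals C | all? blocked? Γ
    ... | no ¬n | _     | _     = no λ b → ¬n (SetBlockedFor.nonempty b)
    ... | yes _ | no ¬s | _     = no λ b → ¬s (SetBlockedFor.subset b)
    ... | yes _ | yes _ | no ¬b = no λ b → ¬b (All.tabulate (λ {D} → SetBlockedFor.blocked b D))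
    ... | yes n | yes s | yes b =
      yes record { nonempty = n ; subset = s ; blocked = λ D D∈ → All.lookup b D∈ }

  setBlocked? : ∀ Γ C → Dec (SetBlocked Γ C)
  setBlocked? Γ C =
    map′ (λ a → let L , _ , b = find a in L , b)
         -- As `L` lies in `C`, filtering `C` by membership in `L` gives `L` back as a set.
         (λ { (L , b) → lose (filter∈subsets (_∈? L) (literals C))
              (setBlockedFor-resp (λ p → _ , p , set⁺ id id) (set⁺ id id)
                (set⁺ (λ p → ∈-filter⁺ _ (SetBlockedFor.subset b p) p) (proj₂ ∘ ∈-filter⁻ _ {xs = literals C})) b) })
         (any? (λ L → setBlockedFor? L Γ C) (subsets (literals C)))

  inference? : ∀ Γ C → Dec (Inference Γ C)
  inference? Γ C =
    map′ [ (λ a → let E , E∈ , b = find a ; F , F∈ , r = find b in resolution E∈ F∈ r)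
         , [ (λ a → let A , A∈ , w = find a in weakening A∈ w) , setBlocked ]′ ]′
         (λ { (resolution E∈ F∈ r) → inj₁ (lose E∈ (lose F∈ r))
            ; (weakening A∈ w)     → inj₂ (inj₁ (lose A∈ w))
            ; (setBlocked b)       → inj₂ (inj₂ b) })
         (any? (λ E → any? (λ F → isResolvent? E F C) Γ) Γ ⊎-dec
          any? (λ A → isWeakening? A C) Γ ⊎-dec setBlocked? Γ C)

  -- Exhaustive search for refutations of a given size.

  module _ (Γ : CNF V) where

    allLiterals : List (Literal V)
    allLiterals = map pos (var Γ) ++ map neg (var Γ)

    ∈-allLiterals : ∀ l → variableOf l ∈ var Γ → l ∈ allLiterals
    ∈-allLiterals (pos x) p = ∈-++⁺ˡ (∈-map⁺ pos p)
    ∈-allLiterals (neg x) p = ∈-++⁺ʳ (map pos (var Γ)) (∈-map⁺ neg p)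

    clauses : List (Literal V) → List (Clause V)
    clauses K with tautological? (_∈? K) K id
    ... | yes _ = []
    ... | no  n = clause K n ∷ []

    ∈-clauses : ∀ K .(n : ¬ Tautological ⟦ K ⟧) → clause K n ∈ clauses K
    ∈-clauses K n with tautological? (_∈? K) K id
    ... | yes t = ⊥-elim-irr (n t)
    ... | no  _ = here refl

    candidates : List (Clause V)
    candidates = concatMap clauses (subsets allLiterals)

    -- Filtering the fixed list `allLiterals` gives a list that depends only on the set of literals
    -- of `C`.
    canonical : ∀ C → varsL (literals C) ⊆ var Γ → ∃[ C′ ] C′ ∈ candidates × C ≈ C′
    canonical (clause K n) vs =
      clause K′ (λ t → n (Taut-map ⟦ K′ ⟧ ⟦ K ⟧ K′⊆K t))
      , ∈-concatMap⁺ clauses (lose (filter∈subsets (_∈? K) allLiterals) (∈-clauses K′ _))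
      , set⁺ (λ {l} p → ∈-filter⁺ _ (∈-allLiterals l (vs (∈-map⁺ variableOf p))) p) K′⊆K
      where
      K′ : List (Literal V)
      K′ = filter (_∈? K) allLiterals
      K′⊆K : K′ ⊆ K
      K′⊆K = proj₂ ∘ ∈-filter⁻ _ {xs = allLiterals}

    step? : ∀ Δ C → Dec (varsL (literals C) ⊆ var Γ × Inference Δ C)
    step? Δ C = (varsL (literals C) ⊆ᵛ? var Γ) ×-dec inference? Δ C

    successors : CNF V → List (CNF V)
    successors Δ = map (_∷ Δ) (filter (step? Δ) candidates)

    -- The index counts the CNFs of the sequence, so `Γ` alone has index 1.
    reachable : ℕ → List (CNF V)
    reachable zero          = []
    reachable (suc zero)    = Γ ∷ []
    reachable (suc (suc N)) = concatMap successors (reachable (suc N))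

    reachable-sound : ∀ N {Δ} → Δ ∈ reachable N → Derivation Γ Δ N
    reachable-sound (suc zero) (here refl) = start
    reachable-sound (suc (suc N)) p with find (∈-concatMap⁻ successors {xs = reachable (suc N)} p)
    ... | Δ , Δ∈ , q with ∈-map⁻ (_∷ Δ) q
    ... | C , C∈ , refl =
      reachable-sound (suc N) Δ∈ ▸ proj₂ (∈-filter⁻ (step? Δ) {xs = candidates} C∈)

    -- The derivation is replayed with canonical clauses; both inclusions are carried along for
    -- `inference-resp`.
    reachable-complete : ∀ {N Δ} → Derivation Γ Δ N → ∃[ Δ′ ] Δ′ ∈ reachable N × Δ ≼ Δ′ × Δ′ ≼ Δ
    reachable-complete start = Γ , here refl , (λ p → _ , p , set⁺ id id) , (λ p → _ , p , set⁺ id id)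
    reachable-complete (_▸_ {N = zero} () _)
    reachable-complete (_▸_ {N = suc N} {C = C} d (vs , i)) =
      let Δ′ , Δ′∈ , s , t = reachable-complete d
          C′ , C′∈ , c     = canonical C vs
          inferred : varsL (literals C′) ⊆ var Γ × Inference Δ′ C′
          inferred         = vs ∘ varsL-mono (set-⊇ c) , inference-resp s t c i
      in C′ ∷ Δ′
         , ∈-concatMap⁺ successors
             (lose Δ′∈ (∈-map⁺ (_∷ Δ′) (∈-filter⁺ (step? Δ′) C′∈ inferred)))
         , ≼-∷ c s , ≼-∷ (set-sym c) t

    refutation? : Decidable (Refutation Γ)
    refutation? N =
      map′ (λ a → let Δ , Δ∈ , p = find a in Δ , reachable-sound N Δ∈ , p)
           complete
           (any? (any? empty?) (reachable N))
      where
      complete : Refutation Γ N → Any (Any (⊥ᶜ ≡_)) (reachable N)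
      complete (Δ , d , p) with reachable-complete d
      ... | Δ′ , Δ′∈ , s , _ with s p
      ... | E , E∈ , e = lose Δ′∈ (subst (_∈ Δ′) (sym (⊥ᶜ-unique e)) E∈)

    minimumSize : ∀ {N} → Refutation Γ N → ∃[ s ] IsSize Γ s
    minimumSize {N} = least refutation? N

-- Bounded sequences of inferences under an invariant.

module _ {V : Set} where

  -- The list itself is fixed, so that later arguments can compute with it; passing to another list
  -- of the same set costs one weakening.
  Has : List (Literal V) → CNF V → Set
  Has K Δ = ∃[ D ] D ∈ Δ × literals D ≡ K

  Each : (List (Literal V) → Set) → CNF V → Set
  Each I Δ = ∀ {D} → D ∈ Δ → I (literals D)

  -- At most b inferences lead from Δ to Δ′, and every inferred clause satisfies I.
  data Extends (I : List (Literal V) → Set) : CNF V → CNF V → ℕ → Set where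
    done  : ∀ {Δ b} → Extends I Δ Δ b
    infer : ∀ {Δ Δ′ b} C → Inference Δ C → I (literals C) → Extends I (C ∷ Δ) Δ′ b →
            Extends I Δ Δ′ (suc b)

  Reach : (List (Literal V) → Set) → CNF V → ℕ → (CNF V → Set) → Set
  Reach I Δ b Q = ∃[ Δ′ ] Extends I Δ Δ′ b × Q Δ′

  Has-mono : ∀ {K Δ Δ′} → Δ ⊆ Δ′ → Has K Δ → Has K Δ′
  Has-mono s (D , p , e) = D , s p , e

  module _ {I : List (Literal V) → Set} where

    Extends-⊆ : ∀ {Δ Δ′ b} → Extends I Δ Δ′ b → Δ ⊆ Δ′
    Extends-⊆ done            p = p
    Extends-⊆ (infer _ _ _ e) p = Extends-⊆ e (there p)

    Extends-Each : ∀ {Δ Δ′ b} → Extends I Δ Δ′ b → Each I Δ → Each I Δ′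
    Extends-Each done            a = a
    Extends-Each (infer _ _ i e) a = Extends-Each e λ { (here refl) → i ; (there p) → a p }

    Extends-≤ : ∀ {Δ Δ′ b c} → b ≤ c → Extends I Δ Δ′ b → Extends I Δ Δ′ c
    Extends-≤ _       done            = done
    Extends-≤ (s≤s p) (infer C i j e) = infer C i j (Extends-≤ p e)

    Extends-trans : ∀ {Δ Δ′ Δ″ b c} → Extends I Δ Δ′ b → Extends I Δ′ Δ″ c → Extends I Δ Δ″ (b + c)
    Extends-trans {b = b} done  f = Extends-≤ (m≤n+m _ b) f
    Extends-trans (infer C i j e) f = infer C i j (Extends-trans e f)

    Reach-≤ : ∀ {Δ b c Q} → b ≤ c → Reach I Δ b Q → Reach I Δ c Q
    Reach-≤ p (Δ′ , e , q) = Δ′ , Extends-≤ p e , q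

    Reach-bind : ∀ {Δ b c} {Q R : CNF V → Set} → Reach I Δ b Q →
                 (∀ {Δ′} → Extends I Δ Δ′ b → Q Δ′ → Reach I Δ′ c R) → Reach I Δ (b + c) R
    Reach-bind (Δ′ , e , q) k = let Δ″ , f , r = k e q in Δ″ , Extends-trans e f , r

    Reach-infer : ∀ {Δ b Q} C → Inference Δ C → I (literals C) → Reach I (C ∷ Δ) b Q → Reach I Δ (suc b) Q
    Reach-infer C i j (Δ′ , e , q) = Δ′ , infer C i j e , q

    -- The goals are reached one after another, so each step must start from any later CNF that
    -- keeps the invariant, and each goal must survive additions.
    forEach : ∀ {X : Set} {b} {G : X → CNF V → Set} (xs : List X) →
              (∀ x {Δ Δ′} → Δ ⊆ Δ′ → G x Δ → G x Δ′) →
              ∀ {Δ} → Each I Δ → (∀ x {Δ′} → Δ ⊆ Δ′ → Each I Δ′ → Reach I Δ′ b (G x)) →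
              Reach I Δ (length xs * b) (λ Δ′ → ∀ {x} → x ∈ xs → G x Δ′)
    forEach []       mono a step = _ , done , λ ()
    forEach {G = G} (x ∷ xs) mono a step =
      Reach-bind (step x id a) λ e g →
        let Δ″ , f , h = forEach {G = G} xs mono (Extends-Each e a) (λ y s → step y (s ∘ Extends-⊆ e))
        in Δ″ , f , λ { (here refl) → mono x (Extends-⊆ f) g ; (there p) → h p }

    forFin : ∀ {m b} {G : Fin m → CNF V → Set} →
             (∀ x {Δ Δ′} → Δ ⊆ Δ′ → G x Δ → G x Δ′) →
             ∀ {Δ} → Each I Δ → (∀ x {Δ′} → Δ ⊆ Δ′ → Each I Δ′ → Reach I Δ′ b (G x)) →
             Reach I Δ (m * b) (λ Δ′ → ∀ x → G x Δ′)
    forFin {m} {b} {G} mono {Δ} a step =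
      let Δ′ , e , g = forEach {G = G} (allFin m) mono a step
      in Δ′ , subst (λ c → Extends I Δ Δ′ (c * b)) (length-tabulate {n = m} id) e , λ x → g (∈-allFin x)

  Reach-map : ∀ {I J : List (Literal V) → Set} {Δ b Q} → (∀ K → I K → J K) →
              Reach I Δ b Q → Reach J Δ b Q
  Reach-map {I} {J} f (Δ′ , e , q) = Δ′ , go e , q
    where
    go : ∀ {Δ Δ′ b} → Extends I Δ Δ′ b → Extends J Δ Δ′ b
    go done            = done
    go (infer C i j e) = infer C i (f _ j) (go e)

  derivation : ∀ {I Γ Δ Δ′ M b} → (∀ v → v ∈ var Γ) → Derivation Γ Δ M → Extends I Δ Δ′ b →
               ∃[ N ] N ≤ b + M × Derivation Γ Δ′ N
  derivation {M = M} {b} all d done = M , m≤n+m M b , d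
  derivation {M = M} {suc b} all d (infer C i _ e) =
    let N , N≤ , d′ = derivation all (d ▸ ((λ {v} _ → all v) , i)) e
    in N , subst (N ≤_) (+-suc b M) N≤ , d′

  pos-++-nontautological : ∀ vs {T : List (Literal V)} → (∀ {v} → v ∈ vs → v ∉ varsL T) →
                           ¬ Tautological ⟦ T ⟧ → ¬ Tautological ⟦ map pos vs ++ T ⟧
  pos-++-nontautological vs {T} disjoint n (x , p , q) with ∈-++⁻ (map pos vs) p | ∈-++⁻ (map pos vs) q
  ... | _       | inj₁ q′ with ∈-map⁻ pos q′
  ...   | _ , _ , ()
  pos-++-nontautological vs disjoint n (x , p , q) | inj₂ p′ | inj₂ q′ = n (x , p′ , q′)
  pos-++-nontautological vs disjoint n (x , p , q) | inj₁ p′ | inj₂ q′ with ∈-map⁻ pos p′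
  ... | _ , x∈vs , refl = disjoint x∈vs (∈-map⁺ variableOf q′)

  when : ∀ {I Δ b P Q} → Dec P → (P → Reach I Δ b Q) → Reach I Δ b (λ Δ′ → P → Q Δ′)
  when (no ¬p) _ = _ , done , λ p → ⊥-elim (¬p p)
  when (yes p) f = let Δ′ , e , q = f p in Δ′ , e , λ _ → q

-- Resolving away positive literals.

module _ {V : Set} (_≟_ : DecidableEquality V) where

  open import Data.List.Membership.DecPropositional _≟_ using (_∈?_)

  -- As `B` lies in `T`, resolving with this clause on `v` adds nothing to a clause that contains
  -- `T`.
  Refuter : List (Literal V) → CNF V → V → Set
  Refuter T Δ v = ∃[ B ] Has (neg v ∷ B) Δ × B ⊆ T

  module _ {I : List (Literal V) → Set} {T : List (Literal V)} (n : ¬ Tautological ⟦ T ⟧) where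

    -- Pivots go from the front, and each intermediate clause is `T` with some pivots left; `inv`
    -- covers all of these.
    resolveAll : ∀ {Δ} vs → (∀ {v} → v ∈ vs → v ∉ varsL T) → (∀ us → us ⊆ vs → I (map pos us ++ T)) →
                 (∀ {v} → v ∈ vs → Refuter T Δ v) → Has (map pos vs ++ T) Δ → Reach I Δ (length vs) (Has T)
    resolveAll []       _        _   _       h = _ , done , h
    resolveAll {Δ} (v ∷ vs) disjoint inv refuter (E , E∈ , E≡) =
      Reach-infer C inference (inv vs there)
        (resolveAll vs (disjoint ∘ there) (λ us s → inv us (there ∘ s))
          (λ p → let B , h , s = refuter (there p) in B , Has-mono there h , s)
          (C , here refl , refl))
      where
      C : Clause V
      C = clause (map pos vs ++ T) (pos-++-nontautological vs (disjoint ∘ there) n)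
      inference : Inference Δ C
      inference with v ∈? vs
      -- With another copy of `v` left, `v` cannot serve as pivot; the shorter list has the same
      -- literals, so it is a weakening.
      ... | yes v∈vs = weakening E∈ (weaken⁺ {A = E} {C} (λ {l} p → shrink (subst (l ∈_) E≡ p)))
        where
        shrink : pos v ∷ map pos vs ++ T ⊆ map pos vs ++ T
        shrink (here refl) = ∈-++⁺ˡ (∈-map⁺ pos v∈vs)
        shrink (there p)   = p
      ... | no v∉vs with refuter (here refl)
      ...   | B , (F , F∈ , F≡) , B⊆T = resolution E∈ F∈ record
        { x = v ; A = map pos vs ++ T ; B = B
        ; left  = subst (_∼[ set ] (pos v ∷ map pos vs ++ T)) (sym E≡) (set⁺ id id)
        ; right = subst (_∼[ set ] (neg v ∷ B)) (sym F≡) (set⁺ id id)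
        ; x∉A = v∉A
        ; x∉B = λ p → disjoint (here refl) (varsL-mono B⊆T p)
        ; union = set⁺ ∈-++⁺ˡ ([ id , ∈-++⁺ʳ (map pos vs) ∘ B⊆T ]′ ∘ ∈-++⁻ (map pos vs ++ T)) }
        where
        v∉A : v ∉ varsL (map pos vs ++ T)
        v∉A p with ∈-map⁻ variableOf p
        ... | l , q , refl with ∈-++⁻ (map pos vs) q
        ...   | inj₂ r = disjoint (here refl) (∈-map⁺ variableOf r)
        ...   | inj₁ r with ∈-map⁻ pos r
        ...     | _ , w , refl = v∉vs w

    weakenAndResolveAll :
      ∀ {Δ} vs → (∀ {v} → v ∈ vs → v ∉ varsL T) → (∀ us → us ⊆ vs → I (map pos us ++ T)) →
      (∀ {v} → v ∈ vs → Refuter T Δ v) → ∀ {K} → K ⊆ map pos vs ++ T → Has K Δ →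
      Reach I Δ (suc (length vs)) (Has T)
    weakenAndResolveAll vs disjoint inv refuter K⊆ (E , E∈ , refl) =
      Reach-infer C (weakening E∈ (weaken⁺ {A = E} {C} K⊆)) (inv vs id)
        (resolveAll vs disjoint inv (λ p → let B , h , s = refuter p in B , Has-mono there h , s)
          (C , here refl , refl))
      where
      C : Clause V
      C = clause (map pos vs ++ T) (pos-++-nontautological vs disjoint n)

-- The exchange of two pigeons as a clause.

module _ {n : ℕ} where

  _≟ᵖ_ : DecidableEquality (PVar n)
  _≟ᵖ_ = ≡-dec _≟_ _≟_

  -- The transposition that moves pigeon i from hole h to hole k, and the last pigeon
  -- suc h from hole k to hole h, makes exactly these four literals true.
  swapped : Fin n → Fin (suc n) → Fin n → List (Literal (PVar n))
  swapped h i k = neg (suc h , k) ∷ neg (i , h) ∷ pos (i , k) ∷ pos (suc h , h) ∷ []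

  notLast? : ∀ h → Decidable (λ (j : Fin (suc n)) → j ≢ suc h)
  notLast? h j = ¬? (j ≟ suc h)

  third? : ∀ h i → Decidable (λ (j : Fin (suc n)) → j ≢ i × j ≢ suc h)
  third? h i j = ¬? (j ≟ i) ×-dec ¬? (j ≟ suc h)

  -- The variables to be resolved away with hole clauses: third pigeons in holes `k` and `h`, and
  -- also (i,k), whose positive literal belongs to `swapped`.
  others : Fin n → Fin (suc n) → Fin n → List (PVar n)
  others h i k = map (_, k) (filter (notLast? h) (allFin (suc n))) ++
                 map (_, h) (filter (third? h i) (allFin (suc n)))

  unswapped : Fin n → Fin (suc n) → Fin n → List (Literal (PVar n))
  unswapped h i k = neg (suc h , k) ∷ neg (i , h) ∷ []

  -- This clause fails only if pigeon `suc h` is in hole `k`, pigeon `i` is in hole `h`, and both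
  -- holes are otherwise empty. The exchange repairs it.
  swapLiterals : Fin n → Fin (suc n) → Fin n → List (Literal (PVar n))
  swapLiterals h i k = map pos (others h i k) ++ pos (suc h , h) ∷ unswapped h i k

  row : Fin (suc n) → ℕ → List (PVar n)
  row j t = map (j ,_) (filter (λ k → toℕ k <? t) (allFin n))

  others⁺ˡ : ∀ h i k {j} → j ≢ suc h → (j , k) ∈ others h i k
  others⁺ˡ h i k p = ∈-++⁺ˡ (∈-map⁺ (_, k) (∈-filter⁺ (notLast? h) (∈-allFin _) p))

  others⁺ʳ : ∀ h i k {j} → j ≢ i → j ≢ suc h → (j , h) ∈ others h i k
  others⁺ʳ h i k p q = ∈-++⁺ʳ (map (_, k) (filter (notLast? h) (allFin (suc n))))
    (∈-map⁺ (_, h) (∈-filter⁺ (third? h i) (∈-allFin _) (p , q)))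

  others⁻ : ∀ h i k {j c} → (j , c) ∈ others h i k →
            j ≢ suc h × (c ≡ k ⊎ (c ≡ h × j ≢ i))
  others⁻ h i k p with ∈-++⁻ (map (_, k) (filter (notLast? h) (allFin (suc n)))) p
  ... | inj₁ q with ∈-map⁻ (_, k) q
  ...   | _ , r , refl = proj₂ (∈-filter⁻ (notLast? h) {xs = allFin (suc n)} r) , inj₁ refl
  others⁻ h i k p | inj₂ q with ∈-map⁻ (_, h) q
  ...   | _ , r , refl with ∈-filter⁻ (third? h i) {xs = allFin (suc n)} r
  ...     | _ , j≢i , j≢a = j≢a , inj₂ (refl , j≢i)

  row⁺ : ∀ {j t k} → toℕ k < t → (j , k) ∈ row j t
  row⁺ {j} {t} p = ∈-map⁺ (j ,_) (∈-filter⁺ (λ k → toℕ k <? t) (∈-allFin _) p)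

  row⁻ : ∀ {i j t k} → (i , k) ∈ row j t → i ≡ j × toℕ k < t
  row⁻ {j = j} {t} p with ∈-map⁻ (j ,_) p
  ... | _ , q , refl = refl , proj₂ (∈-filter⁻ (λ k → toℕ k <? t) {xs = allFin n} q)

  -- Clauses that do not obstruct an exchange.

  Safe : Fin n → Fin (suc n) → Fin n → List (Literal (PVar n)) → Set
  Safe h i k D = ⟦ D ⟧ ≬ ⟦ map complement (swapped h i k) ⟧ → ⟦ D ⟧ ⊥ ⟦ swapped h i k ⟧ →
                 Tautological ((⟦ swapLiterals h i k ⟧ ∖ ⟦ swapped h i k ⟧) ∪
                               (⟦ D ⟧ ∖ ⟦ map complement (swapped h i k) ⟧))

  -- `Safe` is the blocking test of one clause against one exchange; the exchanges of levels below
  -- `t` are those still to come when the holes from `t` on are gone.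
  Below : ℕ → List (Literal (PVar n)) → Set
  Below t D = ∀ h i k → toℕ h < t → toℕ i ≤ toℕ h → toℕ k < toℕ h → Safe h i k D

  Below-≤ : ∀ {s t} → s ≤ t → ∀ D → Below t D → Below s D
  Below-≤ s≤t D b h i k h<s = b h i k (<-≤-trans h<s s≤t)

  pigeon≢last : ∀ {h : Fin n} {i : Fin (suc n)} → toℕ i ≤ toℕ h → i ≢ suc h
  pigeon≢last p refl = 1+n≰n p

  toℕ-<⇒≢ : ∀ {m} {i j : Fin m} → toℕ i < toℕ j → i ≢ j
  toℕ-<⇒≢ p refl = n≮n _ p

  -- The swap clause can only be falsified when the holes k and h contain no third pigeon j.
  vacated : ∀ {h i k j c} D → neg (j , c) ∈ D → j ≢ i → j ≢ suc h → c ≡ k ⊎ c ≡ h →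
            Tautological ((⟦ swapLiterals h i k ⟧ ∖ ⟦ swapped h i k ⟧) ∪
                          (⟦ D ⟧ ∖ ⟦ map complement (swapped h i k) ⟧))
  vacated {h} {i} {k} {j} {c} D p j≢i j≢a c∈ =
    (j , c) , inj₁ (∈-++⁺ˡ (∈-map⁺ pos (other c∈)) , unswappedPos) , inj₂ (p , unswappedNeg)
    where
    other : c ≡ k ⊎ c ≡ h → (j , c) ∈ others h i k
    other (inj₁ refl) = others⁺ˡ h i k j≢a
    other (inj₂ refl) = others⁺ʳ h i k j≢i j≢a
    unswappedPos : pos (j , c) ∉ swapped h i k
    unswappedPos (there (there (here refl)))         = j≢i refl
    unswappedPos (there (there (there (here refl)))) = j≢a refl
    unswappedNeg : neg (j , c) ∉ map complement (swapped h i k)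
    unswappedNeg (there (there (here refl)))         = j≢i refl
    unswappedNeg (there (there (there (here refl)))) = j≢a refl

  -- The exchange makes p(h+1,k) and p(i,h) false. A clause with one of them contains p(h+1,h) or
  -- p(i,k) respectively, which becomes true, since the row reaches beyond hole `h`.
  row-Below : ∀ j t {D} → map pos (row j t) ⊆ D → (∀ {l} → l ∈ D → ∃[ k ] l ≡ pos (j , k)) → Below t D
  row-Below j t {D} row⊆D D⊆ h i k h<t i≤h k<h (l , l∈D , l∈L̄) D⊥L with D⊆ l∈D
  row-Below j t row⊆D D⊆ h i k h<t i≤h k<h (_ , _ , here refl) D⊥L | _ , refl =
    ⊥-elim (D⊥L (row⊆D (∈-map⁺ pos (row⁺ h<t)) , there (there (there (here refl)))))
  row-Below j t row⊆D D⊆ h i k h<t i≤h k<h (_ , _ , there (here refl)) D⊥L | _ , refl =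
    ⊥-elim (D⊥L (row⊆D (∈-map⁺ pos (row⁺ (<-trans k<h h<t))) , there (there (here refl))))
  row-Below j t row⊆D D⊆ h i k h<t i≤h k<h (_ , _ , there (there (there (there ())))) D⊥L | _ , refl

  -- The exchange endangers ¬p(i,k) and ¬p(h+1,h). The other literal of the clause is made true by
  -- the exchange or concerns a third pigeon, and then `vacated` applies.
  hole-Below : ∀ {j l c} t → j ≢ l → Below t (neg (j , c) ∷ neg (l , c) ∷ [])
  hole-Below {j} {l} {c} t j≢l h i k h<t i≤h k<h (m , m∈D , m∈L̄) D⊥L = split m∈D m∈L̄
    where
    D = neg (j , c) ∷ neg (l , c) ∷ []
    other : ∀ {j′ l′} → neg (l′ , c) ∈ D → j′ ≢ l′ → neg (j′ , c) ∈ map complement (swapped h i k) →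
            Tautological ((⟦ swapLiterals h i k ⟧ ∖ ⟦ swapped h i k ⟧) ∪
                          (⟦ D ⟧ ∖ ⟦ map complement (swapped h i k) ⟧))
    other {l′ = l′} p j≢l (there (there (here refl))) with l′ ≟ suc h
    ... | yes refl = ⊥-elim (D⊥L (p , here refl))
    ... | no  l≢a  = vacated D p (j≢l ∘ sym) l≢a (inj₁ refl)
    other {l′ = l′} p j≢l (there (there (there (here refl)))) with l′ ≟ i
    ... | yes refl = ⊥-elim (D⊥L (p , there (here refl)))
    ... | no  l≢i  = vacated D p l≢i (j≢l ∘ sym) (inj₂ refl)
    split : ∀ {m} → m ∈ D → m ∈ map complement (swapped h i k) → _
    split (here refl)         q = other (there (here refl)) j≢l q
    split (there (here refl)) q = other (here refl) (j≢l ∘ sym) q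

  -- The variables that leave at level `h`; exchanges of lower levels do not touch them.
  Remote : Fin n → PVar n → Set
  Remote h v = proj₁ v ≡ suc h ⊎ proj₂ v ≡ h

  -- Pigeon `suc h` is a third pigeon for every lower exchange. So if a positive literal of hole `c`
  -- is touched, the accompanying literal ¬p(h+1,c) lets `vacated` apply.
  remote-Below : ∀ h D → (∀ {l} → l ∈ D → Remote h (variableOf l) ⊎
                   (∃[ v ] l ≡ pos v × neg (suc h , proj₂ v) ∈ D)) → Below (toℕ h) D
  remote-Below h₀ D D⊆ h i k h<h₀ i≤h k<h (l , l∈D , l∈L̄) D⊥L = go (D⊆ l∈D) l∈L̄
    where
    h≢ : h ≢ h₀
    h≢ = toℕ-<⇒≢ h<h₀
    k≢ : k ≢ h₀
    k≢ = toℕ-<⇒≢ (<-trans k<h h<h₀)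
    i≢ : suc h₀ ≢ i
    i≢ refl = <⇒≱ (s≤s (<⇒≤ h<h₀)) i≤h
    a≢ : suc h₀ ≢ suc h
    a≢ refl = h≢ refl
    go : ∀ {l} → Remote h₀ (variableOf l) ⊎ (∃[ v ] l ≡ pos v × neg (suc h₀ , proj₂ v) ∈ D) →
         l ∈ map complement (swapped h i k) →
         Tautological ((⟦ swapLiterals h i k ⟧ ∖ ⟦ swapped h i k ⟧) ∪
                       (⟦ D ⟧ ∖ ⟦ map complement (swapped h i k) ⟧))
    go (inj₁ (inj₁ e)) (here refl)                         = ⊥-elim (a≢ (sym e))
    go (inj₁ (inj₂ e)) (here refl)                         = ⊥-elim (k≢ e)
    go (inj₁ (inj₁ e)) (there (here refl))                 = ⊥-elim (i≢ (sym e))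
    go (inj₁ (inj₂ e)) (there (here refl))                 = ⊥-elim (h≢ e)
    go (inj₁ (inj₁ e)) (there (there (here refl)))         = ⊥-elim (i≢ (sym e))
    go (inj₁ (inj₂ e)) (there (there (here refl)))         = ⊥-elim (k≢ e)
    go (inj₁ (inj₁ e)) (there (there (there (here refl)))) = ⊥-elim (a≢ (sym e))
    go (inj₁ (inj₂ e)) (there (there (there (here refl)))) = ⊥-elim (h≢ e)
    go (inj₂ (_ , refl , q)) (here refl)         = vacated D q i≢ a≢ (inj₁ refl)
    go (inj₂ (_ , refl , q)) (there (here refl)) = vacated D q i≢ a≢ (inj₂ refl)
    go (inj₂ (_ , refl , _)) (there (there (there (there ()))))

  Below-suc : ∀ h {D} → Below (toℕ h) D →
              (∀ i k → toℕ i ≤ toℕ h → toℕ k < toℕ h → Safe h i k D) → Below (suc (toℕ h)) D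
  Below-suc h b s h′ i k h′<t with m≤n⇒m<n∨m≡n (m<1+n⇒m≤n h′<t)
  ... | inj₁ h′<h = b h′ i k h′<h
  ... | inj₂ h′≡h with toℕ-injective h′≡h
  ...   | refl = s i k

  unswapped-remote : ∀ {h i k l} → l ∈ unswapped h i k → Remote h (variableOf l)
  unswapped-remote (here refl)         = inj₁ refl
  unswapped-remote (there (here refl)) = inj₂ refl

  -- The only negative literals that an exchange of level `h` makes false have the form ¬p(i,k) with
  -- `i` at most `h` and `k` below `h`, or ¬p(h+1,h); neither form occurs here.
  unswapped-Below : ∀ {h i k} → toℕ i ≤ toℕ h → toℕ k < toℕ h → Below (suc (toℕ h)) (unswapped h i k)
  unswapped-Below {h} {i₀} {k₀} i₀≤h k₀<h =
    Below-suc h (remote-Below h _ (inj₁ ∘ unswapped-remote))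
      λ i k i≤h k<h → λ { (_ , p , q) _ → ⊥-elim (untouched i≤h k<h p q) }
    where
    untouched : ∀ {i k} → toℕ i ≤ toℕ h → toℕ k < toℕ h →
                ∀ {l} → l ∈ unswapped h i₀ k₀ → l ∉ map complement (swapped h i k)
    untouched i≤h k<h (here refl) (there (there (here e)))         = pigeon≢last i≤h (sym (pigeon≡ e))
      where
      pigeon≡ : ∀ {u v} → neg u ≡ neg v → proj₁ u ≡ proj₁ v
      pigeon≡ refl = refl
    untouched i≤h k<h (here refl) (there (there (there (here refl)))) = toℕ-<⇒≢ k₀<h refl
    untouched i≤h k<h (there (here refl)) (there (there (here refl))) = toℕ-<⇒≢ k<h refl
    untouched i≤h k<h (there (here refl)) (there (there (there (here refl)))) = pigeon≢last i₀≤h refl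

  -- Every exchange of level `h` makes p(h+1,h) true, so a clause with this literal passes the test
  -- at that level.
  last∈-Below : ∀ h D → pos (suc h , h) ∈ D →
                (∀ {l} → l ∈ D → Remote h (variableOf l) ⊎
                  (∃[ v ] l ≡ pos v × neg (suc h , proj₂ v) ∈ D)) → Below (suc (toℕ h)) D
  last∈-Below h D p D⊆ = Below-suc h (remote-Below h D D⊆)
    λ i k _ _ _ D⊥L → ⊥-elim (D⊥L (p , there (there (there (here refl)))))

  -- Variables of hole `h` are remote, and the literals of hole `k` are accompanied by ¬p(h+1,k).
  others-Below : ∀ h i k us → us ⊆ others h i k →
                 Below (suc (toℕ h)) (map pos us ++ pos (suc h , h) ∷ unswapped h i k)
  others-Below h i k us us⊆ = last∈-Below h D (∈-++⁺ʳ (map pos us) (here refl)) classify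
    where
    D = map pos us ++ pos (suc h , h) ∷ unswapped h i k
    classify : ∀ {l} → l ∈ D → Remote h (variableOf l) ⊎ (∃[ v ] l ≡ pos v × neg (suc h , proj₂ v) ∈ D)
    classify p with ∈-++⁻ (map pos us) p
    ... | inj₂ (here refl) = inj₁ (inj₁ refl)
    ... | inj₂ (there q)   = inj₁ (unswapped-remote q)
    ... | inj₁ q with ∈-map⁻ pos q
    ...   | v , v∈ , refl with others⁻ h i k (us⊆ v∈)
    ...     | _ , inj₁ refl       = inj₂ (v , refl , ∈-++⁺ʳ (map pos us) (there (here refl)))
    ...     | _ , inj₂ (refl , _) = inj₁ (inj₂ refl)

  last-Below : ∀ {h i k} → toℕ i ≤ toℕ h → toℕ k < toℕ h → ∀ us → us ⊆ (suc h , h) ∷ [] →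
               Below (suc (toℕ h)) (map pos us ++ unswapped h i k)
  last-Below i≤h k<h [] _ = unswapped-Below i≤h k<h
  last-Below {h} {i} {k} i≤h k<h us@(_ ∷ _) us⊆ = last∈-Below h D last∈D (inj₁ ∘ remote)
    where
    D = map pos us ++ unswapped h i k
    last∈D : pos (suc h , h) ∈ D
    last∈D with us⊆ (here refl)
    ... | here refl = here refl
    remote : ∀ {l} → l ∈ D → Remote h (variableOf l)
    remote p with ∈-++⁻ (map pos us) p
    ... | inj₂ q = unswapped-remote q
    ... | inj₁ q with ∈-map⁻ pos q
    ...   | _ , r , refl with us⊆ r
    ...     | here refl = inj₁ refl

  -- Stages of the descent and the removal of one hole.

  Holes : CNF (PVar n) → Set
  Holes Δ = ∀ {j l} c → j ≢ l → Has (neg (j , c) ∷ neg (l , c) ∷ []) Δ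

  -- The pigeonhole principle for pigeons 0 to `t` and the holes below `t`, inside a CNF that keeps
  -- all older clauses.
  record Stage (t : ℕ) (Δ : CNF (PVar n)) : Set where
    field
      rows  : ∀ j → toℕ j ≤ t → Has (map pos (row j t)) Δ
      holes : Holes Δ
      safe  : Each (Below t) Δ

  Holes-mono : ∀ {Δ Δ′} → Δ ⊆ Δ′ → Holes Δ → Holes Δ′
  Holes-mono s holes c j≢l = Has-mono s (holes c j≢l)

  -- One set-blocked clause, one resolution on p(h+1,h), and one inference for each entry of
  -- `others`.
  swapCost : ℕ
  swapCost = 2 + (suc n + suc n)

  length-others : ∀ h i k → length (others h i k) ≤ suc n + suc n
  length-others h i k =
    ≤-trans (≤-reflexive (length-++ (map (_, k) (filter (notLast? h) (allFin (suc n))))))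
      (+-mono-≤ (bound (_, k) (notLast? h)) (bound (_, h) (third? h i)))
    where
    bound : ∀ (f : Fin (suc n) → PVar n) {P : Pred (Fin (suc n)) 0ℓ} (P? : Decidable P) →
            length (map f (filter P? (allFin (suc n)))) ≤ suc n
    bound f P? = ≤-trans (≤-reflexive (length-map f (filter P? (allFin (suc n)))))
      (≤-trans (length-filter P? (allFin (suc n))) (≤-reflexive (length-tabulate id)))

  length-row : ∀ j t → length (row j t) ≤ n
  length-row j t = ≤-trans (≤-reflexive (length-map _ (filter (λ k → toℕ k <? t) (allFin n))))
    (≤-trans (length-filter _ (allFin n)) (≤-reflexive (length-tabulate id)))

  -- Third pigeons in hole `k`, and `i` itself, clash there with pigeon `suc h`; those in hole `h`
  -- clash with pigeon `i`. The invariant includes level `h`, because further exchanges of this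
  -- level follow.
  forbidSwap : ∀ h i k {Δ} → toℕ i ≤ toℕ h → toℕ k < toℕ h → Holes Δ → Each (Below (suc (toℕ h))) Δ →
               Reach (Below (suc (toℕ h))) Δ swapCost (Has (unswapped h i k))
  forbidSwap h i k {Δ} i≤h k<h holes safe =
    Reach-≤ (s≤s (≤-trans (+-mono-≤ (length-others h i k) (≤-refl {1})) (≤-reflexive (+-comm _ 1))))
      (Reach-infer C (setBlocked (swapped h i k , blockedFor)) (others-Below h i k (others h i k) id)
        (Reach-bind
          (resolveAll _≟ᵖ_ consistent′ (others h i k) others-disjoint (others-Below h i k)
            (λ p → refuter (others⁻ h i k p)) (C , here refl , refl))
          -- p(h+1,h) goes last: while it is present, `last∈-Below` keeps the clauses safe at level
          -- `h`.
          (λ e last∨ → resolveAll _≟ᵖ_ consistent (last ∷ []) last-disjoint (last-Below i≤h k<h)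
            (λ { (here refl) → _ , Has-mono (Extends-⊆ e ∘ there) (holes h (i≢a ∘ sym))
                               , λ { (here refl) → there (here refl) } })
            last∨)))
    where
    last : PVar n
    last = suc h , h
    i≢a : i ≢ suc h
    i≢a = pigeon≢last i≤h
    k≢h : k ≢ h
    k≢h = toℕ-<⇒≢ k<h
    consistent : ¬ Tautological ⟦ unswapped h i k ⟧
    consistent (_ , there (there ()) , _)
    last-disjoint : ∀ {v} → v ∈ last ∷ [] → v ∉ varsL (unswapped h i k)
    last-disjoint (here refl) (here e)         = k≢h (sym (cong proj₂ e))
    last-disjoint (here refl) (there (here e)) = i≢a (sym (cong proj₁ e))
    consistent′ : ¬ Tautological ⟦ pos last ∷ unswapped h i k ⟧
    consistent′ = pos-++-nontautological (last ∷ []) last-disjoint consistent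
    others-disjoint : ∀ {v} → v ∈ others h i k → v ∉ varsL (pos last ∷ unswapped h i k)
    others-disjoint p (here refl)         = proj₁ (others⁻ h i k p) refl
    others-disjoint p (there (here refl)) = proj₁ (others⁻ h i k p) refl
    others-disjoint p (there (there (here refl))) with others⁻ h i k p
    ... | _ , inj₁ h≡k       = k≢h (sym h≡k)
    ... | _ , inj₂ (_ , i≢i) = i≢i refl
    C : Clause (PVar n)
    C = clause (swapLiterals h i k) (pos-++-nontautological (others h i k) others-disjoint consistent′)
    tail⊆ : pos last ∷ unswapped h i k ⊆ swapLiterals h i k
    tail⊆ = ∈-++⁺ʳ (map pos (others h i k))
    blockedFor : SetBlockedFor (swapped h i k) Δ C
    blockedFor = record
      { nonempty = λ ()
      ; subset   = λ { (here refl)                         → tail⊆ (there (here refl))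
                     ; (there (here refl))                 → tail⊆ (there (there (here refl)))
                     ; (there (there (here refl)))         → ∈-++⁺ˡ (∈-map⁺ pos (others⁺ˡ h i k i≢a))
                     ; (there (there (there (here refl)))) → tail⊆ (here refl) }
      ; blocked  = λ D D∈Δ → safe D∈Δ h i k ≤-refl i≤h k<h }
    refuter : ∀ {j c} → j ≢ suc h × (c ≡ k ⊎ (c ≡ h × j ≢ i)) →
              Refuter _≟ᵖ_ (pos last ∷ unswapped h i k) (C ∷ Δ) (j , c)
    refuter (j≢a , inj₁ refl) = _ , Has-mono there (holes k j≢a) , λ { (here refl) → there (here refl) }
    refuter (_ , inj₂ (refl , j≢i)) =
      _ , Has-mono there (holes h j≢i) , λ { (here refl) → there (there (here refl)) }

  -- With pigeon `i` in hole `h`, pigeon `suc h` has no place: `unswapped` excludes the holes below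
  -- `h`, a hole clause excludes `h`. No exchange of level `h` follows, so safety below `h`
  -- suffices.
  forbidHole : ∀ h i {Δ} → toℕ i ≤ toℕ h → Holes Δ → Has (map pos (row (suc h) (suc (toℕ h)))) Δ →
               (∀ k → toℕ k < toℕ h → Has (unswapped h i k) Δ) →
               Reach (Below (toℕ h)) Δ (suc n) (Has (neg (i , h) ∷ []))
  forbidHole h i {Δ} i≤h holes lastRow unswappable =
    Reach-≤ (s≤s (length-row (suc h) (suc (toℕ h))))
      (weakenAndResolveAll _≟ᵖ_ consistent (row (suc h) (suc (toℕ h))) disjoint invariant refuter
        ∈-++⁺ˡ lastRow)
    where
    consistent : ¬ Tautological ⟦ neg (i , h) ∷ [] ⟧
    consistent (_ , there () , _)
    disjoint : ∀ {v} → v ∈ row (suc h) (suc (toℕ h)) → v ∉ (i , h) ∷ []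
    disjoint p (here refl) = pigeon≢last i≤h (proj₁ (row⁻ p))
    invariant : ∀ us → us ⊆ row (suc h) (suc (toℕ h)) → Below (toℕ h) (map pos us ++ neg (i , h) ∷ [])
    invariant us us⊆ = remote-Below h _ (inj₁ ∘ remote)
      where
      remote : ∀ {l} → l ∈ map pos us ++ neg (i , h) ∷ [] → Remote h (variableOf l)
      remote p with ∈-++⁻ (map pos us) p
      ... | inj₂ (here refl) = inj₂ refl
      ... | inj₁ q with ∈-map⁻ pos q
      ...   | _ , r , refl = inj₁ (proj₁ (row⁻ (us⊆ r)))
    refuter : ∀ {v} → v ∈ row (suc h) (suc (toℕ h)) → Refuter _≟ᵖ_ (neg (i , h) ∷ []) Δ v
    refuter {j , c} p with row⁻ p
    ... | refl , c<1+h with m≤n⇒m<n∨m≡n (m<1+n⇒m≤n c<1+h)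
    ...   | inj₁ c<h = _ , unswappable c c<h , id
    ...   | inj₂ c≡h with toℕ-injective c≡h
    ...     | refl = _ , holes h (pigeon≢last i≤h ∘ sym) , id

  shortenRow : ∀ h i {Δ} → Has (neg (i , h) ∷ []) Δ → Has (map pos (row i (suc (toℕ h)))) Δ →
               Reach (Below (toℕ h)) Δ 2 (Has (map pos (row i (toℕ h))))
  shortenRow h i unit long =
    -- The weakening only moves p(i,h) to the front; the unit clause then removes it.
    weakenAndResolveAll _≟ᵖ_ consistent ((i , h) ∷ []) disjoint invariant
      (λ { (here refl) → [] , unit , λ () }) split long
    where
    consistent : ¬ Tautological ⟦ map pos (row i (toℕ h)) ⟧
    consistent (_ , _ , q) with ∈-map⁻ pos q
    ... | _ , _ , ()
    disjoint : ∀ {v} → v ∈ (i , h) ∷ [] → v ∉ varsL (map pos (row i (toℕ h)))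
    disjoint (here refl) p with ∈-map⁻ variableOf p
    ... | _ , q , refl with ∈-map⁻ pos q
    ...   | _ , r , refl = n≮n _ (proj₂ (row⁻ r))
    invariant : ∀ us → us ⊆ (i , h) ∷ [] → Below (toℕ h) (map pos us ++ map pos (row i (toℕ h)))
    invariant us us⊆ = row-Below i (toℕ h) (∈-++⁺ʳ (map pos us)) positive
      where
      positive : ∀ {l} → l ∈ map pos us ++ map pos (row i (toℕ h)) → ∃[ k ] l ≡ pos (i , k)
      positive p with ∈-++⁻ (map pos us) p
      positive p | inj₁ q with ∈-map⁻ pos q
      ... | _ , r , refl with us⊆ r
      ...   | here refl = h , refl
      positive p | inj₂ q with ∈-map⁻ pos q
      ... | (_ , k) , r , refl with row⁻ r
      ...   | refl , _ = k , refl
    split : map pos (row i (suc (toℕ h))) ⊆ pos (i , h) ∷ map pos (row i (toℕ h))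
    split p with ∈-map⁻ pos p
    ... | (_ , c) , q , refl with row⁻ q
    ...   | refl , c<1+h with m≤n⇒m<n∨m≡n (m<1+n⇒m≤n c<1+h)
    ...     | inj₁ c<h = there (∈-map⁺ pos (row⁺ c<h))
    ...     | inj₂ c≡h with toℕ-injective c≡h
    ...       | refl = here refl

  levelCost : ℕ
  levelCost = suc n * (n * swapCost) + (suc n * suc n + suc n * 2)

  level : ∀ h {Δ} → Stage (suc (toℕ h)) Δ → Reach (Below (toℕ h)) Δ levelCost (Stage (toℕ h))
  level h {Δ} stage =
    Reach-bind swaps λ e₁ unswappable →
    Reach-bind (holesExcluded e₁ unswappable) λ e₂ units →
    let e = λ {D} → Extends-⊆ e₂ {D} ∘ Extends-⊆ e₁ {D}
        Δ′ , e₃ , shortened = rowsShortened e (λ {D} → Extends-Each e₂ (Extends-Each e₁ safe₀) {D}) units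
    in Δ′ , e₃ , record
      { rows  = shortened
      ; holes = λ c j≢l → Has-mono (Extends-⊆ e₃ ∘ e) (holes c j≢l)
      ; safe  = Extends-Each e₃ (Extends-Each e₂ (Extends-Each e₁ safe₀)) }
    where
    open Stage stage
    safe₀ : Each (Below (toℕ h)) Δ
    safe₀ {D} p = Below-≤ (n≤1+n _) (literals D) (safe p)

    Unswappable : Fin (suc n) → Fin n → CNF (PVar n) → Set
    Unswappable i k Δ = toℕ i ≤ toℕ h × toℕ k < toℕ h → Has (unswapped h i k) Δ

    swaps : Reach (Below (toℕ h)) Δ (suc n * (n * swapCost)) (λ Δ′ → ∀ i k → Unswappable i k Δ′)
    -- All exchanges of the level run under the stronger invariant, which is relaxed afterwards.
    swaps = Reach-map (Below-≤ (n≤1+n _))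
      (forFin {G = λ i Δ′ → ∀ k → Unswappable i k Δ′} (λ i s g k p → Has-mono s (g k p)) safe λ i s safe′ →
       forFin {G = Unswappable i} (λ k s g p → Has-mono s (g p)) safe′ λ k s′ safe″ →
       when (toℕ i ≤? toℕ h ×-dec toℕ k <? toℕ h) λ (i≤h , k<h) →
       forbidSwap h i k i≤h k<h (Holes-mono (s′ ∘ s) holes) safe″)

    Unit : Fin (suc n) → CNF (PVar n) → Set
    Unit i Δ = toℕ i ≤ toℕ h → Has (neg (i , h) ∷ []) Δ

    holesExcluded : ∀ {Δ′} → Extends (Below (toℕ h)) Δ Δ′ (suc n * (n * swapCost)) →
                    (∀ i k → Unswappable i k Δ′) →
                    Reach (Below (toℕ h)) Δ′ (suc n * suc n) (λ Δ″ → ∀ i → Unit i Δ″)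
    holesExcluded e unswappable =
      forFin {G = Unit} (λ i s g p → Has-mono s (g p)) (Extends-Each e safe₀) λ i s _ →
      when (toℕ i ≤? toℕ h) λ i≤h →
      forbidHole h i i≤h (Holes-mono (s ∘ Extends-⊆ e) holes)
        (Has-mono (s ∘ Extends-⊆ e) (rows (suc h) ≤-refl))
        (λ k k<h → Has-mono s (unswappable i k (i≤h , k<h)))

    Shortened : Fin (suc n) → CNF (PVar n) → Set
    Shortened i Δ = toℕ i ≤ toℕ h → Has (map pos (row i (toℕ h))) Δ

    rowsShortened : ∀ {Δ′} → Δ ⊆ Δ′ → Each (Below (toℕ h)) Δ′ → (∀ i → Unit i Δ′) →
                    Reach (Below (toℕ h)) Δ′ (suc n * 2) (λ Δ″ → ∀ i → Shortened i Δ″)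
    rowsShortened e safe′ units =
      forFin {G = Shortened} (λ i s g p → Has-mono s (g p)) safe′ λ i s _ →
      when (toℕ i ≤? toℕ h) λ i≤h →
      shortenRow h i (Has-mono s (units i i≤h)) (Has-mono (s ∘ e) (rows i (≤-trans i≤h (n≤1+n _))))

  -- The complete refutation.

  stage₀ : Stage n (PHP n)
  stage₀ = record
    { rows  = λ j _ → pigeonClause n j , ∈-++⁺ˡ (∈-map⁺ (pigeonClause n) (∈-allFin j)) , pigeon≡ j
    ; holes = λ {j} {l} c j≢l → holeClause n (j , l , c)
              , ∈-++⁺ʳ pigeons (∈-map⁺ (holeClause n) (∈-filter⁺ distinct?
                  (∈-cartesianProduct⁺ (∈-allFin j) (∈-cartesianProduct⁺ (∈-allFin l) (∈-allFin c))) j≢l))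
              , refl
    ; safe  = safe }
    where
    pigeons : CNF (PVar n)
    pigeons = map (pigeonClause n) (allFin (suc n))
    triples : List (Fin (suc n) × Fin (suc n) × Fin n)
    triples = cartesianProduct (allFin (suc n)) (cartesianProduct (allFin (suc n)) (allFin n))
    distinct? : Decidable (λ ((i , j , _) : Fin (suc n) × Fin (suc n) × Fin n) → i ≢ j)
    distinct? (i , j , _) = ¬? (i ≟ j)
    pigeon≡ : ∀ j → literals (pigeonClause n j) ≡ map pos (row j n)
    pigeon≡ j = trans (map-∘ (allFin n)) (cong (λ ks → map pos (map (j ,_) ks))
      (sym (filter-all (λ k → toℕ k <? n) (All.tabulate (λ {k} _ → toℕ<n k)))))
    safe : Each (Below n) (PHP n)
    safe p with ∈-++⁻ pigeons p
    safe p | inj₁ q with ∈-map⁻ (pigeonClause n) q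
    ... | j , _ , refl = row-Below j n (λ {l} r → subst (l ∈_) (sym (pigeon≡ j)) r) positive
      where
      positive : ∀ {l} → l ∈ literals (pigeonClause n j) → ∃[ k ] l ≡ pos (j , k)
      positive r with ∈-map⁻ (λ k → pos (j , k)) r
      ... | k , _ , l≡ = k , l≡
    safe p | inj₂ q with ∈-map⁻ (holeClause n) q
    ... | (j , l , c) , r , refl = hole-Below n (proj₂ (∈-filter⁻ distinct? {xs = triples} r))

  -- The invariant changes with the level and is recorded in `Stage`, so the joined sequence carries
  -- a trivial one.
  descend : ∀ t → t ≤ n → ∀ {Δ} → Stage t Δ → Reach (λ _ → ⊤) Δ (t * levelCost) (Stage 0)
  descend zero    _   stage = _ , done , stage
  descend (suc t) t<n stage =
    Reach-bind (step (fromℕ< t<n) (toℕ-fromℕ< t<n) stage) λ _ → descend t (<⇒≤ t<n)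
    where
    step : ∀ {t Δ} (h : Fin n) → toℕ h ≡ t → Stage (suc t) Δ → Reach (λ _ → ⊤) Δ levelCost (Stage t)
    step h refl stage = Reach-map _ (level h stage)

  -- No hole is left for pigeon 0, so its clause is empty.
  Stage-0-⊥ : ∀ {Δ} → Stage 0 Δ → ⊥ᶜ ∈ Δ
  Stage-0-⊥ {Δ} stage =
    let E , E∈ , E≡ = Stage.rows stage zero z≤n
    in subst (_∈ Δ) (sym (⊥ᶜ-unique (set⁺ (λ ()) (λ {l} p → empty (subst (l ∈_) E≡ p))))) E∈
    where
    empty : ∀ {l} → l ∈ map pos (row zero 0) → l ∈ []
    empty p with ∈-map⁻ pos p
    ... | _ , q , refl with row⁻ q
    ...   | _ , ()

  occurs : ∀ v → v ∈ var (PHP n)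
  occurs (i , k) = ∈-concatMap⁺ (varsL ∘ literals)
    (lose (∈-++⁺ˡ (∈-map⁺ (pigeonClause n) (∈-allFin i)))
          (∈-map⁺ variableOf (∈-map⁺ (λ k → pos (i , k)) (∈-allFin k))))

  -- The summand 1 counts the initial CNF.
  refutation : ∃[ N ] N ≤ n * levelCost + 1 × Refutation (PHP n) N
  refutation =
    let Δ , e , stage = descend n ≤-refl stage₀
        N , N≤ , d    = derivation occurs start e
    in N , N≤ , Δ , d , Stage-0-⊥ stage

-- The polynomial bound.

refutationBound : ∀ n → 4 ≤ n → n * levelCost {n} + 1 ≤ n ^ 8
refutationBound n@(suc (suc (suc (suc _)))) 4≤n@(s≤s (s≤s (s≤s (s≤s _)))) = begin
  n * levelCost {n} + 1     ≤⟨ +-mono-≤ (*-monoʳ-≤ n level≤) (m^n>0 n 7) ⟩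
  n ^ 7 + n ^ 7             ≤⟨ 2* (n ^ 7) ⟩
  n ^ 8                     ∎
  where
  open ≤-Reasoning
  2* : ∀ x → x + x ≤ n * x
  2* x = +-monoʳ-≤ x (m≤m+n x _)
  3* : ∀ x → x + (x + x) ≤ n * x
  3* x = +-monoʳ-≤ x (+-monoʳ-≤ x (m≤m+n x _))
  power : ∀ {x y} a b → x ≤ n ^ a → y ≤ n ^ b → x * y ≤ n ^ (a + b)
  power {x} {y} a b p q = begin
    x * y         ≤⟨ *-mono-≤ p q ⟩
    n ^ a * n ^ b ≡⟨ ^-distribˡ-+-* n a b ⟨
    n ^ (a + b)   ∎
  n≤ : n ≤ n ^ 1
  n≤ = ≤-reflexive (sym (*-identityʳ n))
  1+n≤ : suc n ≤ n ^ 2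
  1+n≤ = begin
    1 + n      ≤⟨ +-monoˡ-≤ n {1} {n} (s≤s z≤n) ⟩
    n + n      ≤⟨ 2* n ⟩
    n * n      ≡⟨ cong (n *_) (*-identityʳ n) ⟨
    n ^ 2      ∎
  swap≤ : swapCost {n} ≤ n ^ 2
  swap≤ = begin
    2 + (suc n + suc n) ≡⟨ cong (2 +_) (cong suc (+-suc n n)) ⟩
    -- Here 4 ≤ n absorbs the constant.
    4 + (n + n)         ≤⟨ +-monoˡ-≤ (n + n) 4≤n ⟩
    n + (n + n)         ≤⟨ 3* n ⟩
    n * n               ≡⟨ cong (n *_) (*-identityʳ n) ⟨
    n ^ 2               ∎
  level≤ : levelCost {n} ≤ n ^ 6
  level≤ = begin
    -- The exchanges cost at most n^5; the units and the rows at most n^4 each, rounded up to n^5.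
    levelCost {n}           ≤⟨ +-mono-≤ (power 2 3 1+n≤ (power 1 2 n≤ swap≤))
                                 (+-mono-≤ (≤-trans (power 2 2 1+n≤ 1+n≤) (^-monoʳ-≤ n (n≤1+n 4)))
                                   (≤-trans (power 2 2 1+n≤ (≤-trans (s≤s (s≤s z≤n)) 1+n≤)) (^-monoʳ-≤ n (n≤1+n 4)))) ⟩
    n ^ 5 + (n ^ 5 + n ^ 5) ≤⟨ 3* (n ^ 5) ⟩
    n ^ 6                   ∎

lemma7p1 : ∃[ size ] (∀ (n : ℕ) → .{{_ : NonZero n}} → IsSize (PHP n) (size n)) × PolynomiallyBounded size
lemma7p1 =
  -- Exponent 8 from n = 4 on; minimality carries the bound from the explicit refutation to the
  -- size.
  (λ n → proj₁ (minimal n)) , (λ n → proj₂ (minimal n)) , 8 , 4 , λ n 4≤n →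
    let N , N≤ , r = refutation {n}
    in ≤-trans (proj₂ (proj₂ (minimal n)) N r) (≤-trans N≤ (refutationBound n 4≤n))
  where
  minimal : ∀ n → ∃[ s ] IsSize (PHP n) s
  minimal n = minimumSize _≟ᵖ_ (PHP n) (proj₂ (proj₂ (refutation {n})))
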